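{- Let $\mathcal R = (\Sigma, E, R)$ be a rewrite theory with a given set of strategy definitions, let $AP_\Pi$ be a set of atomic propositions with labeling function $L_\Pi : T_{\Sigma/E} \to \mathcal P(AP_\Pi)$, and let $\mathcal M$ be the Kripke structure with states $T_{\Sigma/E}$, transition relation $\to^1_R$, all states initial, and labeling $L_\Pi$. Let $\alpha$ be a strategy expression and $t$ a ground term. Let $\mathcal M_{\alpha,t}$ be the Kripke structure with state set $\mathcal{XS} \times \{0\} \cup \mathrm{Sol} \times \{1\}$, single initial state $(t \mathbin{@} \alpha, 0)$, transitions $(q,0) \to (q',0)$ whenever $q \twoheadrightarrow q'$ and $(q,k) \to (q,1)$ for all $q \in \mathrm{Sol}$ and $k \in \{0,1\}$, and labeling $(q,k) \mapsto L_\Pi(\mathrm{cterm}(q))$. Then for any linear-time property $\varphi$, $$(\mathcal M, E(\alpha, t)) \vDash \varphi \iff \mathcal M_{\alpha,t} \vDash \varphi .$$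
   Context: **Satisfaction.** A linear-time property $\varphi$ is (identified with) a set of propositional traces in $\mathcal P(AP_\Pi)^\omega$, and a trace satisfies $\varphi$ if it belongs to the set. A Kripke structure satisfies $\varphi$ if the labelings of all its infinite executions from initial states satisfy $\varphi$. For a set $F$ of executions of $\mathcal M$, $(\mathcal M,F)\vDash\varphi$ means that $L_\Pi(\pi)$ satisfies $\varphi$ for all $\pi\in F$ ($L_\Pi$ applied letterwise), where any finite execution $w_0\cdots w_n\in F$ is read as its stuttering extension $w_0\cdots w_n w_n w_n\cdots$. **Rewriting.** $\mathcal R = (\Sigma, E, R)$ is a rewrite theory over a membership equational theory $(\Sigma,E)$, with labeled rules, possibly conditional, with condition fragments that are equations, sort memberships, or rewriting conditions $l \Rightarrow p$. Terms are considered modulo $E$; $T_\Sigma$ denotes ground terms and $T_{\Sigma/E}$ their classes modulo $E$ (brackets are omitted). $t \to^1_R t'$ is one-step rewriting. **Strategy expressions.** Core grammar: $\alpha ::= \mathtt{idle} \mid \mathtt{fail} \mid \mathtt{match}\,P\,\mathtt{s.t.}\,C \mid \alpha;\alpha \mid \alpha|\alpha \mid \alpha^* \mid \alpha\,?\,\alpha:\alpha \mid \mathtt{matchrew}\,P\,\mathtt{s.t.}\,C\,\mathtt{by}\,x_1\,\mathtt{using}\,\alpha_1,\ldots,x_n\,\mathtt{using}\,\alpha_n \mid sl(t_1,\ldots,t_n) \mid \mathtt{all} \mid rl[\rho]\{\alpha_1,\ldots,\alpha_m\}$, where $C$ is an equational condition, $rl$ is a rule label, $\rho$ is an optional initial substitution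 $x_1 \leftarrow t_1,\ldots$, the list of $m\ge0$ strategies is for a rule with $m$ rewriting conditions, and $sl$ is a strategy name given by definitions $sl(p_1,\ldots,p_n) := \delta$ (optionally: if an equational condition holds), which may be mutually recursive. Rule applications may be wrapped in $\mathtt{top}(\cdot)$ to apply only at the root. (Variants $\mathtt{amatch}$, $\mathtt{amatchrew}$ match at any position; $\mathtt{xmatch}$, $\mathtt{xmatchrew}$ match with extension.) Other combinators are abbreviations. **Execution states** $\mathcal{XS}$: $q ::= t \mathbin{@} s \mid \mathrm{subterm}(x_1:q_1,\ldots,x_n:q_n;t)\mathbin{@} s \mid \mathrm{rewc}(p:q,\sigma,C,\vec\alpha,\theta,r,c;t)\mathbin{@} s$, with stacks $s ::= \varepsilon \mid \alpha s \mid \theta s$ of strategy expressions $\alpha$ and substitutions $\theta$. $\mathrm{vctx}(\theta s)=\theta$, $\mathrm{vctx}(\varepsilon)=\mathrm{id}$, $\mathrm{vctx}(\alpha s)=\mathrm{vctx}(s)$. Current term: $\mathrm{cterm}(t\mathbin{@} s)=t$, $\mathrm{cterm}(\mathrm{rewc}(\ldots;t)\mathbin{@} s)=t$, $\mathrm{cterm}(\mathrm{subterm}(x_1:q_1,\ldots,x_n:q_n;t)\mathbin{@} s)=t[x_1/\mathrm{cterm}(q_1),\ldots,x_n/\mathrm{cterm}(q_n)]$. States $t\mathbin{@}\varepsilon$ are solutions. **Transitions** ($\to_c$ control, $\to_s$ system, $\to_{s,c} = \to_s\cup\to_c$), where $\theta=\mathrm{vctx}(s)$ instantiates the variables of the expressions: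 - $t\mathbin{@}\mathtt{idle}\,s\to_c t\mathbin{@} s$; no rule for $\mathtt{fail}$; $t\mathbin{@}\theta' s\to_c t\mathbin{@} s$ (popping a substitution). - $t\mathbin{@}(\mathtt{match}\,P\,\mathtt{s.t.}\,C)\,s\to_c t\mathbin{@} s$ if $t$ matches $P$ satisfying $C$. - $t\mathbin{@}(\alpha;\beta)s\to_c t\mathbin{@}\alpha\beta s$; $t\mathbin{@}(\alpha|\beta)s\to_c t\mathbin{@}\alpha s$ and $\to_c t\mathbin{@}\beta s$; $t\mathbin{@}\alpha^* s\to_c t\mathbin{@} s$ and $\to_c t\mathbin{@}\alpha\,\alpha^* s$. - $t\mathbin{@}(\alpha?\beta:\gamma)s\to_c t\mathbin{@}\alpha\beta s$; and $t\mathbin{@}(\alpha?\beta:\gamma)s\to_c t\mathbin{@}\gamma s$ if $\to_{s,c}$ is terminating from $t\mathbin{@}\alpha\theta$ and reaches no solution from it. - $t\mathbin{@}\mathtt{all}\,s\to_s t'\mathbin{@} s$ if $t\to^1_R t'$. For a rule labeled $rl$ without rewriting conditions, $t\mathbin{@} rl[\rho]s\to_s t'\mathbin{@} s$ for each $t'$ obtained from $t$ by applying, at some position, that rule instantiated first by $\rho$ (whose terms are instantiated by $\theta$). - For a rule labeled $rl$ with right-hand side $r$ and condition $C_0\wedge l_1\Rightarrow p_1\wedge C'$ with $C_0$ equational and $m\ge1$ rewriting fragments in total: $t\mathbin{@} rl[\rho]\{\alpha_1,\ldots,\alpha_m\}s\to_c\mathrm{rewc}(p_1:\sigma(l_1)\mathbin{@}\alpha_1\theta,\sigma,C',\alpha_2\cdots\alpha_m,\theta,r,c;t)\mathbin{@}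 s$ for each context $c$ and substitution $\sigma$ (extending $\rho$) matching the left-hand side in $t$ and satisfying $C_0$. If $q\to_s q'$ or $q\to_c q'$, then $\mathrm{rewc}(p:q,\ldots)\mathbin{@} s\to_c\mathrm{rewc}(p:q',\ldots)\mathbin{@} s$. For each $\sigma'$ extending $\sigma$ with $\sigma'(p)=t'$ and satisfying the equational condition $C_0$: $\mathrm{rewc}(p:t'\mathbin{@}\varepsilon,\sigma,C_0\wedge l\Rightarrow p'\wedge C,\alpha\vec\alpha,\theta,r,c;t)\mathbin{@} s\to_c\mathrm{rewc}(p':\sigma'(l)\mathbin{@}\alpha\theta,\sigma',C,\vec\alpha,\theta,r,c;t)\mathbin{@} s$, and, when no rewriting fragment remains, $\mathrm{rewc}(p:t'\mathbin{@}\varepsilon,\sigma,C_0,\ldots,r,c;t)\mathbin{@} s\to_s c(\sigma'(r))\mathbin{@} s$. - $t\mathbin{@}(\mathtt{matchrew}\,P\,\mathtt{s.t.}\,C\,\mathtt{by}\,x_1\,\mathtt{using}\,\alpha_1,\ldots)s\to_c\mathrm{subterm}(x_1:\sigma(x_1)\mathbin{@}\alpha_1\sigma,\ldots,x_n:\sigma(x_n)\mathbin{@}\alpha_n\sigma;\sigma_{ -\{x_1,\ldots,x_n\}}(P))\mathbin{@} s$ for each match $\sigma$ of $t$ with $P$ satisfying $C$ and extending $\theta$ ($\sigma_{ -X}$ leaves the variables in $X$ untouched). If $q_i\to_\bullet q_i'$ with $\bullet\in\{s,c\}$, then $\mathrm{subterm}(\ldots,x_i:q_i,\ldots;t)\mathbin{@}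 s\to_\bullet\mathrm{subterm}(\ldots,x_i:q_i',\ldots;t)\mathbin{@} s$. $\mathrm{subterm}(x_1:t_1\mathbin{@}\varepsilon,\ldots,x_n:t_n\mathbin{@}\varepsilon;t)\mathbin{@} s\to_c t[x_1/t_1,\ldots,x_n/t_n]\mathbin{@} s$. - $t\mathbin{@} sl(t_1,\ldots,t_n)s\to_c t\mathbin{@}\delta\sigma s$ for every definition whose left-hand side matches the call instantiated by $\theta$, with substitution $\sigma$ (and condition satisfied), $\delta$ being its right-hand side; if the top of $s$ is a substitution, it is replaced by $\sigma$ (tail call). Control steps preserve $\mathrm{cterm}$, and system steps project to $\to^1_R$ steps. **Denotation.** $\twoheadrightarrow$ is $\to_c^*$ followed by one $\to_s$. $\mathrm{Ex}^*(\alpha,t)=\{q_0\cdots q_n: q_0=t\mathbin{@}\alpha,\ q_k\twoheadrightarrow q_{k+1},\ q_n\to_c^* t'\mathbin{@}\varepsilon \text{ for some } t'\in T_\Sigma\}$, $\mathrm{Ex}^\omega(\alpha,t)=\{(q_k)_{k\ge0}: q_0=t\mathbin{@}\alpha,\ q_k\twoheadrightarrow q_{k+1}\}$, and $E(\alpha,t)=\mathrm{cterm}(\mathrm{Ex}^*(\alpha,t)\cup\mathrm{Ex}^\omega(\alpha,t))$ (cterm applied letterwise). $\mathrm{Sol}=\{q\in\mathcal{XS}: q\to_c^*\mathrm{cterm}(q)\mathbin{@}\varepsilon\}$. -}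

module Defs where

open import Data.Bool.Base using (Bool; true; false)
open import Data.Empty using (⊥)
open import Data.Fin.Base using (Fin; zero; suc; inject₁; fromℕ; fromℕ<)
open import Data.List.Base using (List; []; _∷_; _++_)
open import Data.List.Membership.Propositional using (_∈_)
import Data.List.Membership.DecPropositional as DecMembership
open import Data.List.Relation.Unary.All as All using (All; []; _∷_; _[_]≔_)
open import Data.List.Relation.Unary.Any using (Any)
open import Data.List.Relation.Unary.Unique.Propositional using (Unique)
open import Data.Maybe.Base as Maybe using (Maybe; just; nothing)
open import Data.Nat.Base using (ℕ; zero; suc; s≤s; _⊓_)
open import Data.Nat.Properties using (m⊓n≤n)
open import Data.Product.Base using (Σ; ∃; _×_; _,_; proj₁; proj₂; map₂)
open import Data.Sum.Base using (_⊎_; inj₁; inj₂)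
open import Data.Unit.Base using (⊤; tt)
open import Data.Vec.Base using (Vec; []; _∷_)
open import Function.Base using (_∘_; flip)
open import Function.Bundles using (_⇔_)
open import Induction.WellFounded using (Acc)
open import Level using (Level; 0ℓ) renaming (suc to lsuc)
open import Relation.Binary.Bundles using (Setoid)
open import Relation.Binary.Construct.Closure.ReflexiveTransitive using (Star)
import Relation.Binary.Construct.On as On
open import Relation.Binary.Core using (Rel)
open import Relation.Binary.Definitions using (DecidableEquality; _Respects_; _Respects₂_)
open import Relation.Binary.PropositionalEquality as ≡ using (_≡_; refl)
open import Relation.Binary.Structures using (IsEquivalence)
open import Relation.Nullary.Decidable.Core using (yes; no)
open import Relation.Nullary.Negation.Core using (¬_)
open import Relation.Unary using (Pred; _≐_; U)

private
  variable
    ℓ : Level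

Trace : Set → Set₁
Trace AP = ℕ → Pred AP 0ℓ

-- A set of traces. Letters are subsets of AP, so equality of traces is
-- letterwise mutual inclusion, and membership must respect it.
record Property (AP : Set) ℓ : Set (lsuc 0ℓ Level.⊔ lsuc ℓ) where
  field
    Holds : Pred (Trace AP) ℓ
    resp  : Holds Respects (λ τ τ′ → ∀ n → τ n ≐ τ′ n)

-- A setoid of states, so that states may be equivalence classes.
record Kripke (AP : Set) : Set₁ where
  field
    states : Setoid 0ℓ 0ℓ
  open Setoid states public renaming (Carrier to State; _≈_ to _≈ₛ_)
  field
    _⟶_        : Rel State 0ℓ
    ⟶-resp     : _⟶_ Respects₂ _≈ₛ_
    Initial     : Pred State 0ℓ
    initial-resp : Initial Respects _≈ₛ_
    label       : State → Pred AP 0ℓ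
    label-resp  : ∀ {x y} → x ≈ₛ y → label x ≐ label y

-- fin n w is the word w₀ ⋯ wₙ.
data Word (A : Set) : Set where
  fin : (n : ℕ) → (Fin (suc n) → A) → Word A
  inf : (ℕ → A) → Word A

module _ {A B : Set} where

  mapWord : (A → B) → Word A → Word B
  mapWord f (fin n w) = fin n (f ∘ w)
  mapWord f (inf w)   = inf (f ∘ w)

data PointwiseWord {A : Set} (_∼_ : Rel A 0ℓ) : Rel (Word A) 0ℓ where
  fin : ∀ {n v w} → (∀ i → v i ∼ w i) → PointwiseWord _∼_ (fin n v) (fin n w)
  inf : ∀ {v w}   → (∀ i → v i ∼ w i) → PointwiseWord _∼_ (inf v) (inf w)

-- Finite words are extended by repeating their last letter.
stutter : {A : Set} → Word A → ℕ → A
stutter (fin n w) k = w (fromℕ< (s≤s (m⊓n≤n k n)))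
stutter (inf w)   k = w k

module _ {AP : Set} where

  infix 4 _⊨_ _∣_⊨_

  _⊨_ : Kripke AP → Property AP ℓ → Set ℓ
  K ⊨ φ = ∀ π → Initial (π 0) → (∀ n → π n ⟶ π (suc n)) → Holds (label ∘ π)
    where
    open Kripke K
    open Property φ

  _∣_⊨_ : (K : Kripke AP) → Pred (Word (Kripke.State K)) 0ℓ → Property AP ℓ → Set ℓ
  K ∣ F ⊨ φ = ∀ w → F w → Holds (label ∘ stutter w)
    where
    open Kripke K
    open Property φ

record Signature : Set₁ where
  field
    Kind : Set
    Sort : Kind → Set
    Op   : List Kind → Kind → Set
    Var  : Kind → Set
    _≟_  : DecidableEquality (∃ Var)

module Terms (S : Signature) where
  open Signature S

  private
    variable
      k h h′ : Kind
      ks  : List Kind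
      V W : Kind → Set

  data Term (V : Kind → Set) : Kind → Set where
    var : V k → Term V k
    op  : Op ks k → All (Term V) ks → Term V k

  GTerm : Kind → Set
  GTerm = Term (λ _ → ⊥)

  Pat : Kind → Set
  Pat = Term Var

  mutual
    bind : (∀ {k} → V k → Term W k) → Term V k → Term W k
    bind f (var x)   = f x
    bind f (op o ts) = op o (bind* f ts)

    bind* : (∀ {k} → V k → Term W k) → All (Term V) ks → All (Term W) ks
    bind* f []       = []
    bind* f (t ∷ ts) = bind f t ∷ bind* f ts

  -- Defined only if f is on every variable of the term.
  mutual
    inst : (∀ {k} → V k → Maybe (Term W k)) → Term V k → Maybe (Term W k)
    inst f (var x)   = f x
    inst f (op o ts) = Maybe.map (op o) (inst* f ts)

    inst* : (∀ {k} → V k → Maybe (Term W k)) → All (Term V) ks → Maybe (All (Term W) ks)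
    inst* f []       = just []
    inst* f (t ∷ ts) = Maybe.zipWith _∷_ (inst f t) (inst* f ts)

  wk : GTerm k → Term V k
  wk = bind λ ()

  wk* : All GTerm ks → All (Term V) ks
  wk* = bind* λ ()

  mutual
    data Occurs (x : ∃ Var) : Pat k → Set where
      here : Occurs x (var (proj₂ x))
      arg  : {o : Op ks k} {ts : All Pat ks} → Occurs* x ts → Occurs x (op o ts)

    data Occurs* (x : ∃ Var) : All Pat ks → Set where
      head : {t : Pat k} {ts : All Pat ks} → Occurs x t → Occurs* x (t ∷ ts)
      tail : {t : Pat k} {ts : All Pat ks} → Occurs* x ts → Occurs* x (t ∷ ts)

  -- Ground substitutions with a domain; variables outside it are left
  -- alone.
  Subst : Set
  Subst = ∀ k → Var k → Maybe (GTerm k)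

  idS : Subst
  idS _ _ = nothing

  _∈dom_ : ∃ Var → Subst → Set
  (k , x) ∈dom σ = ∃ λ a → σ k x ≡ just a

  infix 4 _⊢_⇓_ _⊢*_⇓_

  _⊢_⇓_ : Subst → Pat k → GTerm k → Set
  σ ⊢ u ⇓ a = inst (σ _) u ≡ just a

  _⊢*_⇓_ : Subst → All Pat ks → All GTerm ks → Set
  σ ⊢* us ⇓ as = inst* (σ _) us ≡ just as

  -- One-hole contexts: the result has kind k, the hole has kind h.
  data Context (V : Kind → Set) : (k h : Kind) → Set where
    □    : Context V k k
    node : ∀ {ls j rs} → Op (ls ++ j ∷ rs) k →
           All (Term V) ls → Context V j h → All (Term V) rs → Context V k h

  append : ∀ {P : Kind → Set} {ls rs} → All P ls → All P rs → All P (ls ++ rs)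
  append []       qs = qs
  append (p ∷ ps) qs = p ∷ append ps qs

  plug : Context V k h → Term V h → Term V k
  plug □                u = u
  plug (node o ls c rs) u = op o (append ls (plug c u ∷ rs))

  wkᶜ : Context (λ _ → ⊥) k h → Context V k h
  wkᶜ □                = □
  wkᶜ (node o ls c rs) = node o (wk* ls) (wkᶜ c) (wk* rs)

  data EqFragment : Set where
    _≈?_ : Pat k → Pat k → EqFragment
    _∶?_ : Pat k → Sort k → EqFragment

  data OccursEq (x : ∃ Var) : EqFragment → Set where
    lhs  : {u v : Pat k} → Occurs x u → OccursEq x (u ≈? v)
    rhs  : {u v : Pat k} → Occurs x v → OccursEq x (u ≈? v)
    memb : {u : Pat k} {s : Sort k} → Occurs x u → OccursEq x (u ∶? s)

  EqCondition : Set
  EqCondition = List EqFragment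

  -- Conditions with m rewriting fragments, each rewriting fragment
  -- preceded by a possibly empty block of equational ones.
  data Condition : ℕ → Set where
    ⟨_⟩     : EqCondition → Condition 0
    _∧_⇒_∧_ : ∀ {m} → EqCondition → Pat h → Pat h → Condition m → Condition (suc m)

record RewriteTheory : Set₁ where
  field
    signature : Signature
  open Signature signature public
  open Terms signature public
  field
    -- Equation u v C says that u = v if C is one of the axioms of E;
    -- similarly for Membership and, with R in place of E, for Rule.
    Equation   : ∀ {k} → Pat k → Pat k → EqCondition → Set
    Membership : ∀ {k} → Pat k → Sort k → EqCondition → Set
    Label : Set
    Rule  : ∀ {k m} → Label → (lhs rhs : Pat k) → Condition m → Set

module Rewriting (𝓡 : RewriteTheory) where
  open RewriteTheory 𝓡

  private
    variable
      k h h′ : Kind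
      ks  : List Kind

  infix 4 _≈_ _≈*_ _∶_ _⊨ᶠ_ _⊨ᶜ_ _⊢at_ _⊢_→¹_ _↦_ _≈ᵀ_

  mutual
    -- Deduction from E, for ground sentences only: axioms are used
    -- through their ground instances, as in the initial model.
    data _≈_ : GTerm k → GTerm k → Set where
      ≈-refl  : {t : GTerm k} → t ≈ t
      ≈-sym   : {t u : GTerm k} → t ≈ u → u ≈ t
      ≈-trans : {t u v : GTerm k} → t ≈ u → u ≈ v → t ≈ v
      ≈-cong  : (o : Op ks k) {ts us : All GTerm ks} → ts ≈* us → op o ts ≈ op o us
      ≈-axiom : {u v : Pat k} {C : EqCondition} {a b : GTerm k} → Equation u v C →
                (σ : Subst) → All (σ ⊨ᶠ_) C → σ ⊢ u ⇓ a → σ ⊢ v ⇓ b → a ≈ b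

    data _≈*_ : All GTerm ks → All GTerm ks → Set where
      []  : [] ≈* []
      _∷_ : {t u : GTerm k} {ts us : All GTerm ks} →
            t ≈ u → ts ≈* us → (t ∷ ts) ≈* (u ∷ us)

    data _∶_ : GTerm k → Sort k → Set where
      ∶-resp  : {t u : GTerm k} {s : Sort k} → t ≈ u → t ∶ s → u ∶ s
      ∶-axiom : {u : Pat k} {s : Sort k} {C : EqCondition} {a : GTerm k} →
                Membership u s C → (σ : Subst) → All (σ ⊨ᶠ_) C → σ ⊢ u ⇓ a → a ∶ s

    data _⊨ᶠ_ (σ : Subst) : EqFragment → Set where
      eq  : {u v : Pat k} {a b : GTerm k} → σ ⊢ u ⇓ a → σ ⊢ v ⇓ b → a ≈ b → σ ⊨ᶠ (u ≈? v)
      mem : {u : Pat k} {s : Sort k} {a : GTerm k} → σ ⊢ u ⇓ a → a ∶ s → σ ⊨ᶠ (u ∶? s)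

  -- The equality of T_{Σ/E}; terms of different kinds are never equal.
  data _≈ᵀ_ : ∃ GTerm → ∃ GTerm → Set where
    [_] : {t u : GTerm k} → t ≈ u → (k , t) ≈ᵀ (k , u)

  ≈ᵀ-isEquivalence : IsEquivalence _≈ᵀ_
  ≈ᵀ-isEquivalence = record
    { refl  = [ ≈-refl ]
    ; sym   = λ { [ p ] → [ ≈-sym p ] }
    ; trans = λ { [ p ] [ q ] → [ ≈-trans p q ] }
    }

  T/E : Setoid 0ℓ 0ℓ
  T/E = record { isEquivalence = ≈ᵀ-isEquivalence }

  data Where : Set where
    anywhere top : Where

  data _⊢at_ : Where → Context (λ _ → ⊥) k h → Set where
    anywhere : {c : Context (λ _ → ⊥) k h} → anywhere ⊢at c
    top      : top ⊢at □ {k = k}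

  mutual
    data _⊢_→¹_ (w : Where) : GTerm k → GTerm k → Set where
      step : ∀ {m rl} {l r : Pat h} {C : Condition m} {t t′ : GTerm k} {a b : GTerm h} →
             Rule rl l r C → (c : Context (λ _ → ⊥) k h) → w ⊢at c →
             (σ : Subst) → σ ⊨ᶜ C → σ ⊢ l ⇓ a → σ ⊢ r ⇓ b →
             t ≈ plug c a → t′ ≈ plug c b → w ⊢ t →¹ t′

    data _⊨ᶜ_ (σ : Subst) : ∀ {m} → Condition m → Set where
      ⟨_⟩  : {C₀ : EqCondition} → All (σ ⊨ᶠ_) C₀ → σ ⊨ᶜ ⟨ C₀ ⟩
      cond : ∀ {m} {C₀ : EqCondition} {l p : Pat k} {C : Condition m} {a a′ b : GTerm k} →
             All (σ ⊨ᶠ_) C₀ →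
             σ ⊢ l ⇓ a → Star (anywhere ⊢_→¹_) a a′ → a′ ≈ b → σ ⊢ p ⇓ b →
             σ ⊨ᶜ C → σ ⊨ᶜ (C₀ ∧ l ⇒ p ∧ C)

  data _↦_ : ∃ GTerm → ∃ GTerm → Set where
    [_] : {t t′ : GTerm k} → anywhere ⊢ t →¹ t′ → (k , t) ↦ (k , t′)

  ↦-resp : _↦_ Respects₂ _≈ᵀ_
  ↦-resp =
    (λ { [ p ] [ step R c w σ C l r q q′ ] →
         [ step R c w σ C l r q (≈-trans (≈-sym p) q′) ] }) ,
    (λ { [ p ] [ step R c w σ C l r q q′ ] →
         [ step R c w σ C l r (≈-trans (≈-sym p) q) q′ ] })

  record Labeling (AP : Set) : Set₁ where
    field
      L      : ∃ GTerm → Pred AP 0ℓ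
      L-resp : ∀ {x y} → x ≈ᵀ y → L x ≐ L y

  𝓜 : {AP : Set} → Labeling AP → Kripke AP
  𝓜 𝓛 = record
    { states       = T/E
    ; _⟶_          = _↦_
    ; ⟶-resp       = ↦-resp
    ; Initial      = U
    ; initial-resp = λ _ _ → tt
    ; label        = L
    ; label-resp   = L-resp
    }
    where
    open Labeling 𝓛

  -- σ ⊑ τ: τ extends σ.
  infix 4 _⊑_

  _⊑_ : Subst → Subst → Set
  σ ⊑ τ = ∀ {k} (x : Var k) {a} → σ k x ≡ just a →
          ∃ λ b → τ k x ≡ just b × a ≈ b

module Strategies (𝓡 : RewriteTheory)
                  (SName : List (RewriteTheory.Kind 𝓡) → Set) where
  open RewriteTheory 𝓡
  open Rewriting 𝓡

  private
    variable
      k h h′ : Kind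
      ks  : List Kind

  -- Distinguishes match/xmatch/amatch, and likewise for matchrew.
  data Mode : Set where
    at-root with-extension at-any : Mode

  InitialSubst : Set
  InitialSubst = List (∃ λ k → Var k × Pat k)

  infixr 6 _⨾_
  infixr 5 _∪_

  data Strategy : Set where
    idle fail : Strategy
    match    : Mode → Pat k → EqCondition → Strategy
    _⨾_ _∪_  : Strategy → Strategy → Strategy
    _⋆       : Strategy → Strategy
    _¿_∶_    : Strategy → Strategy → Strategy → Strategy
    matchrew : Mode → Pat k → EqCondition →
               (xs : List (∃ Var)) → Unique xs → All (λ _ → Strategy) xs → Strategy
    call     : SName ks → All Pat ks → Strategy
    all      : Where → Strategy
    apply    : ∀ {m} → Where → Label → InitialSubst → Vec Strategy m → Strategy

  -- D sl ps C δ: sl(ps) := δ if C is one of the given definitions.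
  Definitions : Set₁
  Definitions = ∀ {ks} → SName ks → All Pat ks → EqCondition → Strategy → Set

  Associative : Op (k ∷ k ∷ []) k → Set
  Associative f = ∀ x y z →
    op f (op f (x ∷ y ∷ []) ∷ z ∷ []) ≈ op f (x ∷ op f (y ∷ z ∷ []) ∷ [])

  -- The contexts in which P may be matched. With extension, P may cover
  -- a fragment of the arguments of its root symbol, if associative.
  data Position : Mode → Pat h → Context (λ _ → ⊥) k h → Set where
    root  : {P : Pat k} → Position at-root P □
    exact : {P : Pat k} → Position with-extension P □
    left  : ∀ {f : Op (k ∷ k ∷ []) k} {ps} → Associative f → (u : GTerm k) →
            Position with-extension (op f ps)
              (node {ls = []} f [] □ (u ∷ []))
    right : ∀ {f : Op (k ∷ k ∷ []) k} {ps} → Associative f → (u : GTerm k) →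
            Position with-extension (op f ps)
              (node {ls = k ∷ []} f (u ∷ []) □ [])
    both  : ∀ {f : Op (k ∷ k ∷ []) k} {ps} → Associative f → (u v : GTerm k) →
            Position with-extension (op f ps)
              (node {ls = k ∷ []} f (u ∷ []) (node {ls = []} f [] □ (v ∷ [])) [])
    any   : {P : Pat h} {c : Context (λ _ → ⊥) k h} → Position at-any P c

  -- σ extends θ, matches P at c in t and satisfies C. It binds nothing
  -- else, so that other variables remain free in the strategies that σ
  -- will be the context of.
  record Match (θ : Subst) (m : Mode) (P : Pat h) (C : EqCondition)
               (t : GTerm k) (c : Context (λ _ → ⊥) k h) (σ : Subst) : Set where
    field
      extends  : θ ⊑ σ
      domain   : ∀ x → x ∈dom σ → x ∈dom θ ⊎ Occurs x P ⊎ Any (OccursEq x) C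
      position : Position m P c
      {image}  : GTerm h
      instance-of : σ ⊢ P ⇓ image
      matches  : t ≈ plug c image
      holds    : All (σ ⊨ᶠ_) C

  record CallMatch (θ : Subst) (ts ps : All Pat ks) (C : EqCondition) (σ : Subst) : Set where
    field
      domain  : ∀ x → x ∈dom σ → Occurs* x ps ⊎ Any (OccursEq x) C
      {actual formal} : All GTerm ks
      actual-of  : θ ⊢* ts ⇓ actual
      formal-of  : σ ⊢* ps ⇓ formal
      matches : actual ≈* formal
      holds   : All (σ ⊨ᶠ_) C

  -- σ extends ρ, the terms of ρ being instantiated by θ.
  Extends : Subst → InitialSubst → Subst → Set
  Extends θ ρ σ = All (λ (k , x , u) → ∃ λ a → ∃ λ b →
                    θ ⊢ u ⇓ a × σ k x ≡ just b × a ≈ b) ρ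

  infixr 5 _◂_ _▸_

  data Stack : Set where
    ε   : Stack
    _◂_ : Strategy → Stack → Stack
    _▸_ : Subst → Stack → Stack

  vctx : Stack → Subst
  vctx ε       = idS
  vctx (α ◂ s) = vctx s
  vctx (θ ▸ s) = θ

  -- The stack of a called definition, with tail calls.
  enter : Subst → Stack → Stack
  enter σ (θ ▸ s) = σ ▸ s
  enter σ s       = σ ▸ s

  Hole : List (∃ Var) → Kind → Set
  Hole xs k = Σ (Var k) λ x → (k , x) ∈ xs

  infix 4 _at_

  data XS : Kind → Set where
    _at_    : GTerm k → Stack → XS k
    subterm : ∀ {xs} → All (XS ∘ proj₁) xs → Term (Hole xs) k → Stack → XS k
    rewc    : ∀ {m h j} (p : Pat h) (q : XS h) (σ : Subst) (C : Condition m)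
              (αs : Vec Strategy m) (θ : Subst) (r : Pat j)
              (c : Context (λ _ → ⊥) k j) (t : GTerm k) → Stack → XS k

  fill : ∀ {xs} → All (GTerm ∘ proj₁) xs → Term (Hole xs) k → GTerm k
  fill us = bind λ (_ , i) → All.lookup us i

  mutual
    cterm : XS k → GTerm k
    cterm (t at s)                       = t
    cterm (subterm qs b s)               = fill (cterms qs) b
    cterm (rewc p q σ C αs θ r c t s)    = t

    cterms : ∀ {xs} → All (XS ∘ proj₁) xs → All (GTerm ∘ proj₁) xs
    cterms []       = []
    cterms (q ∷ qs) = cterm q ∷ cterms qs

  -- σ_{-xs}(P)
  residual : (xs : List (∃ Var)) → Subst → Pat k → Maybe (Term (Hole xs) k)
  residual xs σ = inst replace
    where
    open DecMembership _≟_ using (_∈?_)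
    replace : ∀ {k} → Var k → Maybe (Term (Hole xs) k)
    replace {k} x with (k , x) ∈? xs
    ... | yes i = just (var (x , i))
    ... | no  _ = Maybe.map wk (σ k x)

  launch : ∀ {xs : List (∃ Var)} → Subst → All (GTerm ∘ proj₁) xs →
           All (λ _ → Strategy) xs → All (XS ∘ proj₁) xs
  launch σ us αs = All.zipWith (λ (u , α) → u at α ◂ σ ▸ ε) (us , αs)

  -- The negative branch of a conditional refers to termination of the
  -- relation being defined, which no strictly positive definition can
  -- do. The rules are therefore relative to a predicate Fails for that
  -- premise, and Semantics requires Fails to be the intended one.
  --
  -- Terms in states are representatives of their classes modulo E: all
  -- rules that inspect a term do so up to _≈_.
  module Transitions (D : Definitions)
                     (Fails : ∀ {k} → GTerm k → Strategy → Subst → Set) where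

    infix 3 _→ᶜ_ _→ˢ_ _→ˢᶜ_ _↠_

    mutual
      data _→ᶜ_ : XS k → XS k → Set where
        idle : ∀ {t : GTerm k} {s} → t at idle ◂ s →ᶜ t at s
        pop  : ∀ {t : GTerm k} {θ s} → t at θ ▸ s →ᶜ t at s
        match : ∀ {t : GTerm k} {m} {P : Pat h} {C c σ s} →
                Match (vctx s) m P C t c σ →
                t at match m P C ◂ s →ᶜ t at s
        seq   : ∀ {t : GTerm k} {α β s} → t at (α ⨾ β) ◂ s →ᶜ t at α ◂ β ◂ s
        alt₁  : ∀ {t : GTerm k} {α β s} → t at (α ∪ β) ◂ s →ᶜ t at α ◂ s
        alt₂  : ∀ {t : GTerm k} {α β s} → t at (α ∪ β) ◂ s →ᶜ t at β ◂ s
        iter₀ : ∀ {t : GTerm k} {α s} → t at (α ⋆) ◂ s →ᶜ t at s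
        iter₁ : ∀ {t : GTerm k} {α s} → t at (α ⋆) ◂ s →ᶜ t at α ◂ (α ⋆) ◂ s
        then  : ∀ {t : GTerm k} {α β γ s} →
                t at (α ¿ β ∶ γ) ◂ s →ᶜ t at α ◂ β ◂ s
        else  : ∀ {t : GTerm k} {α β γ s} → Fails t α (vctx s) →
                t at (α ¿ β ∶ γ) ◂ s →ᶜ t at γ ◂ s
        call  : ∀ {t : GTerm k} {sl : SName ks} {ts ps C δ σ s} →
                D sl ps C δ → CallMatch (vctx s) ts ps C σ →
                t at call sl ts ◂ s →ᶜ t at δ ◂ enter σ s

        matchrew : ∀ {t : GTerm k} {m} {P : Pat h} {C c σ xs us αs b s}
                   {uniq : Unique xs} →
                   Match (vctx s) m P C t c σ →
                   (∀ {k} {x : Var k} (i : (k , x) ∈ xs) → σ k x ≡ just (All.lookup us i)) →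
                   residual xs σ P ≡ just b →
                   t at matchrew m P C xs uniq αs ◂ s →ᶜ
                   subterm (launch σ us αs) (plug (wkᶜ c) b) s
        subterm : ∀ {xs} {qs : All (XS ∘ proj₁) xs} {b : Term (Hole xs) k} {s v q′}
                  (i : v ∈ xs) → All.lookup qs i →ᶜ q′ →
                  subterm qs b s →ᶜ subterm (qs [ i ]≔ q′) b s
        return  : ∀ {xs} {qs : All (XS ∘ proj₁) xs} {b : Term (Hole xs) k} {s}
                  (us : All (GTerm ∘ proj₁) xs) → qs ≡ All.map (_at ε) us →
                  subterm qs b s →ᶜ fill us b at s

        rewc-start : ∀ {m w rl ρ α s σ} {αs : Vec Strategy m} {t : GTerm k}
                     {l r : Pat h} {C₀} {l₁ p₁ : Pat h′} {C a u}
                     {c : Context (λ _ → ⊥) k h} →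
                     Rule rl l r (C₀ ∧ l₁ ⇒ p₁ ∧ C) → w ⊢at c →
                     Extends (vctx s) ρ σ → σ ⊢ l ⇓ a → t ≈ plug c a →
                     All (σ ⊨ᶠ_) C₀ → σ ⊢ l₁ ⇓ u →
                     t at apply w rl ρ (α ∷ αs) ◂ s →ᶜ
                     rewc p₁ (u at α ◂ vctx s ▸ ε) σ C αs (vctx s) r c t s
        rewc-step  : ∀ {m j} {p : Pat h} {q q′ σ C θ} {αs : Vec Strategy m} {r : Pat j}
                     {c} {t : GTerm k} {s} → q →ˢᶜ q′ →
                     rewc p q σ C αs θ r c t s →ᶜ rewc p q′ σ C αs θ r c t s
        rewc-next  : ∀ {m j} {p : Pat h} {t′ σ σ′ α θ} {αs : Vec Strategy m} {r : Pat j}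
                     {c} {t : GTerm k} {s C₀} {l p′ : Pat h′} {C a u} →
                     σ ⊑ σ′ → σ′ ⊢ p ⇓ a → a ≈ t′ →
                     All (σ′ ⊨ᶠ_) C₀ → σ′ ⊢ l ⇓ u →
                     rewc p (t′ at ε) σ (C₀ ∧ l ⇒ p′ ∧ C) (α ∷ αs) θ r c t s →ᶜ
                     rewc p′ (u at α ◂ θ ▸ ε) σ′ C αs θ r c t s

      data _→ˢ_ : XS k → XS k → Set where
        all     : ∀ {t t′ : GTerm k} {w s} → w ⊢ t →¹ t′ →
                  t at all w ◂ s →ˢ t′ at s
        apply   : ∀ {t t′ : GTerm k} {w rl ρ σ s} {l r : Pat h} {C₀ a b}
                  {c : Context (λ _ → ⊥) k h} →
                  Rule rl l r ⟨ C₀ ⟩ → w ⊢at c →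
                  Extends (vctx s) ρ σ → σ ⊢ l ⇓ a → t ≈ plug c a →
                  All (σ ⊨ᶠ_) C₀ → σ ⊢ r ⇓ b → t′ ≈ plug c b →
                  t at apply w rl ρ [] ◂ s →ˢ t′ at s
        subterm : ∀ {xs} {qs : All (XS ∘ proj₁) xs} {b : Term (Hole xs) k} {s v q′}
                  (i : v ∈ xs) → All.lookup qs i →ˢ q′ →
                  subterm qs b s →ˢ subterm (qs [ i ]≔ q′) b s
        rewc-end : ∀ {j} {p : Pat h} {t′ σ σ′ θ} {r : Pat j} {c} {t : GTerm k} {s C₀ a b} →
                   σ ⊑ σ′ → σ′ ⊢ p ⇓ a → a ≈ t′ →
                   All (σ′ ⊨ᶠ_) C₀ → σ′ ⊢ r ⇓ b →
                   rewc p (t′ at ε) σ ⟨ C₀ ⟩ [] θ r c t s →ˢ plug c b at s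

      _→ˢᶜ_ : XS k → XS k → Set
      q →ˢᶜ q′ = q →ˢ q′ ⊎ q →ᶜ q′

    _↠_ : XS k → XS k → Set
    q ↠ q′ = ∃ λ q₁ → Star _→ᶜ_ q q₁ × q₁ →ˢ q′

    Terminating : XS k → Set
    Terminating = Acc (flip _→ˢᶜ_)

    ReachesSolution : XS k → Set
    ReachesSolution q = ∃ λ u → Star _→ˢᶜ_ q (u at ε)

  record Semantics (D : Definitions) : Set₁ where
    field
      Fails : ∀ {k} → GTerm k → Strategy → Subst → Set
    open Transitions D Fails public
    field
      fails⇔ : ∀ {k} (t : GTerm k) α θ →
               Fails t α θ ⇔
               (Terminating (t at α ◂ θ ▸ ε) × ¬ ReachesSolution (t at α ◂ θ ▸ ε))

  module Denotation {D : Definitions} (𝓢 : Semantics D) where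
    open Semantics 𝓢

    data Ex (α : Strategy) (t : GTerm k) : Pred (Word (XS k)) 0ℓ where
      finite   : ∀ {n} {q : Fin (suc n) → XS k} →
                 q zero ≡ (t at α ◂ ε) →
                 (∀ (i : Fin n) → q (inject₁ i) ↠ q (suc i)) →
                 (∃ λ t′ → Star _→ᶜ_ (q (fromℕ n)) (t′ at ε)) →
                 Ex α t (fin n q)
      infinite : ∀ {q : ℕ → XS k} →
                 q 0 ≡ (t at α ◂ ε) →
                 (∀ i → q i ↠ q (suc i)) →
                 Ex α t (inf q)

    -- As a set of words over classes of terms, it is closed under ≈ᵀ.
    E : Strategy → GTerm k → Pred (Word (∃ GTerm)) 0ℓ
    E α t w = ∃ λ v → Ex α t v × PointwiseWord _≈ᵀ_ (mapWord (λ q → _ , cterm q) v) w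

    Sol : Pred (XS k) 0ℓ
    Sol q = ∃ λ u → u ≈ cterm q × Star _→ᶜ_ q (u at ε)

    State : Set
    State = ∃ XS ⊎ ∃ λ (kq : ∃ XS) → Sol (proj₂ kq)

    -- The pair (q , b), forgetting the proof of membership in Sol.
    pair : State → ∃ XS × Bool
    pair (inj₁ q)       = q , false
    pair (inj₂ (q , _)) = q , true

    data _⟶_ : State → State → Set where
      run  : {q q′ : XS k} → q ↠ q′ → inj₁ (k , q) ⟶ inj₁ (k , q′)
      stop : {q : XS k} {s : Sol q} → inj₁ (k , q) ⟶ inj₂ ((k , q) , s)
      stay : {q : XS k} {s s′ : Sol q} → inj₂ ((k , q) , s) ⟶ inj₂ ((k , q) , s′)

    ⟶-resp : _⟶_ Respects₂ (λ x y → pair x ≡ pair y)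
    ⟶-resp = respʳ , respˡ
      where
      respʳ : ∀ {x y z} → pair y ≡ pair z → x ⟶ y → x ⟶ z
      respʳ {z = inj₁ _} refl (run r) = run r
      respʳ {z = inj₂ _} refl stop    = stop
      respʳ {z = inj₂ _} refl stay    = stay

      respˡ : ∀ {x y z} → pair y ≡ pair z → y ⟶ x → z ⟶ x
      respˡ {z = inj₁ _} refl (run r) = run r
      respˡ {z = inj₁ _} refl stop    = stop
      respˡ {z = inj₂ _} refl stay    = stay

    𝓜ₛ : {AP : Set} → Labeling AP → Strategy → GTerm k → Kripke AP
    𝓜ₛ 𝓛 α t = record
      { states       = On.setoid (≡.setoid (∃ XS × Bool)) pair
      ; _⟶_          = _⟶_
      ; ⟶-resp       = ⟶-resp
      ; Initial      = λ x → pair x ≡ ((_ , (t at α ◂ ε)) , false)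
      ; initial-resp = λ p q → ≡.trans (≡.sym p) q
      ; label        = λ x → L (map₂ cterm (proj₁ (pair x)))
      ; label-resp   = λ p → L-resp (IsEquivalence.reflexive ≈ᵀ-isEquivalence
                               (≡.cong (map₂ cterm ∘ proj₁) p))
      }
      where
      open Labeling 𝓛

{-# OPTIONS --safe #-}

-- Control steps preserve the current term up to E, so a finite execution in
-- E(α , t) ends in Sol. Such an execution then matches the path of the Kripke
-- structure that moves to the second copy after its last state and stutters
-- there, and infinite executions match the paths that stay in the first copy.
-- Whether a path ever leaves the first copy is decided by excluded middle.

module Submission where

open import Axiom.ExcludedMiddle using (ExcludedMiddle)
open import Data.Bool.Base using (true; false)
open import Data.Empty using (⊥)
open import Data.Fin.Base using (Fin; zero; suc; inject₁; fromℕ)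
open import Data.List.Base using (List)
open import Data.List.Membership.Propositional using (_∈_)
import Data.List.Membership.DecPropositional as DecMembership
open import Data.List.Relation.Unary.All as All using (All; []; _∷_; _[_]≔_)
open import Data.List.Relation.Unary.Any using (here; there)
open import Data.Maybe.Base using (Maybe; just)
open import Data.Maybe.Properties using (just-injective)
open import Data.Nat.Base using (ℕ; zero; suc)
open import Data.Product.Base using (∃; _×_; _,_; proj₁; proj₂; map₂)
open import Data.Sum.Base using (inj₁; inj₂)
import Data.Vec.Functional as Vector
open import Function.Base using (_∘_)
open import Function.Bundles using (_⇔_; mk⇔)
open import Level using (Level; 0ℓ)
open import Relation.Binary.Construct.Closure.ReflexiveTransitive using (Star; ε; _◅_)
open import Relation.Binary.PropositionalEquality
  using (_≡_; refl; sym; trans; cong; cong₂; subst₂)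
open import Relation.Binary.Structures using (IsEquivalence)
open import Relation.Nullary.Decidable.Core using (yes; no)
open import Relation.Nullary.Negation.Core using (¬_; contradiction)
open import Defs

-- Substitution in ground terms, contexts and two-stage instances

module _ (S : Signature) where
  open Signature S
  open Terms S

  private
    variable
      k h   : Kind
      ks ls rs : List Kind
      V W X : Kind → Set

  mutual
    bind-bind-ground : (f : ∀ {k} → ⊥ → Term V k) (g : ∀ {k} → V k → GTerm k) (t : GTerm k) →
                       bind g (bind f t) ≡ t
    bind-bind-ground f g (op o ts) = cong (op o) (bind*-bind*-ground f g ts)

    bind*-bind*-ground : (f : ∀ {k} → ⊥ → Term V k) (g : ∀ {k} → V k → GTerm k)
                         (ts : All GTerm ks) → bind* g (bind* f ts) ≡ ts
    bind*-bind*-ground f g []       = refl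
    bind*-bind*-ground f g (t ∷ ts) =
      cong₂ _∷_ (bind-bind-ground f g t) (bind*-bind*-ground f g ts)

  bind*-append : (f : ∀ {k} → V k → Term W k) (ts : All (Term V) ls) (us : All (Term V) rs) →
                 bind* f (append ts us) ≡ append (bind* f ts) (bind* f us)
  bind*-append f []       us = refl
  bind*-append f (t ∷ ts) us = cong (bind f t ∷_) (bind*-append f ts us)

  -- A weakened context is ground, so a substitution acts only at its hole. This is the shape in
  -- which `matchrew` builds the body of a `subterm` state.
  bind-plug-wkᶜ : (f : ∀ {k} → V k → GTerm k) (c : Context (λ _ → ⊥) k h) (u : Term V h) →
                  bind f (plug (wkᶜ c) u) ≡ plug c (bind f u)
  bind-plug-wkᶜ f □                u = refl
  bind-plug-wkᶜ f (node o ls c rs) u = cong (op o)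
    (trans (bind*-append f (wk* ls) (plug (wkᶜ c) u ∷ wk* rs))
           (cong₂ append (bind*-bind*-ground _ f ls)
                  (cong₂ _∷_ (bind-plug-wkᶜ f c u) (bind*-bind*-ground _ f rs))))

  module _ {f : ∀ {k} → V k → Maybe (Term W k)} {h : ∀ {k} → V k → Maybe (Term X k)}
           {g : ∀ {k} → W k → Term X k}
           (f≗h : ∀ {k} (x : V k) {b a} → f x ≡ just b → h x ≡ just a → bind g b ≡ a) where
    mutual
      -- Instantiating in two stages, by `f` and then `g`, amounts to the single stage `h` as soon
      -- as it does so on variables. For `matchrew`, `f` leaves holes, `g` fills them and `h` is the
      -- matching substitution.
      bind-inst : (t : Term V k) {b : Term W k} {a : Term X k} →
                  inst f t ≡ just b → inst h t ≡ just a → bind g b ≡ a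
      bind-inst (var x)   p q = f≗h x p q
      bind-inst (op o ts) p q with inst* f ts in p′ | inst* h ts in q′
      bind-inst (op o ts) refl refl | just bs | just as = cong (op o) (bind*-inst* ts p′ q′)

      bind*-inst* : (ts : All (Term V) ks) {bs : All (Term W) ks} {as : All (Term X) ks} →
                    inst* f ts ≡ just bs → inst* h ts ≡ just as → bind* g bs ≡ as
      bind*-inst* []       refl refl = refl
      bind*-inst* (t ∷ ts) p q
        with inst f t in p₁ | inst* f ts in p₂ | inst h t in q₁ | inst* h ts in q₂
      bind*-inst* (t ∷ ts) refl refl | just b | just bs | just a | just as =
        cong₂ _∷_ (bind-inst t p₁ q₁) (bind*-inst* ts p₂ q₂)

-- Congruence modulo E and stuttering of words

module _ (𝓡 : RewriteTheory) where
  open RewriteTheory 𝓡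
  open Rewriting 𝓡

  private
    variable
      k  : Kind
      ks : List Kind
      V  : Kind → Set

  ≈-reflexive : {t u : GTerm k} → t ≡ u → t ≈ u
  ≈-reflexive refl = ≈-refl

  module _ {f g : ∀ {k} → V k → GTerm k} (f≈g : ∀ {k} (x : V k) → f x ≈ g x) where
    mutual
      bind-cong : (t : Term V k) → bind f t ≈ bind g t
      bind-cong (var x)   = f≈g x
      bind-cong (op o ts) = ≈-cong o (bind*-cong ts)

      bind*-cong : (ts : All (Term V) ks) → bind* f ts ≈* bind* g ts
      bind*-cong []       = []
      bind*-cong (t ∷ ts) = bind-cong t ∷ bind*-cong ts

  module _ {AP : Set} (𝓛 : Labeling AP) {ℓ : Level} (φ : Property AP ℓ) where
    open Labeling 𝓛
    open Property φ

    Holds-resp : {τ τ′ : ℕ → ∃ GTerm} → (∀ i → τ i ≈ᵀ τ′ i) → Holds (L ∘ τ) → Holds (L ∘ τ′)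
    Holds-resp τ≈τ′ = resp (λ i → L-resp (τ≈τ′ i))

stutter-mapWord : {A B : Set} (f : A → B) (w : Word A) (i : ℕ) →
                  stutter (mapWord f w) i ≡ f (stutter w i)
stutter-mapWord f (fin n w) i = refl
stutter-mapWord f (inf w)   i = refl

stutter-cong : {A : Set} {_∼_ : A → A → Set} {v w : Word A} →
               PointwiseWord _∼_ v w → ∀ i → stutter v i ∼ stutter w i
stutter-cong (fin p) i = p _
stutter-cong (inf p) i = p i

PointwiseWord-refl : {A : Set} {_∼_ : A → A → Set} → (∀ {x} → x ∼ x) →
                     ∀ w → PointwiseWord _∼_ w w
PointwiseWord-refl r (fin n w) = fin (λ _ → r)
PointwiseWord-refl r (inf w)   = inf (λ _ → r)

-- Control steps and the current term

module _ (𝓡 : RewriteTheory) (SName : List (RewriteTheory.Kind 𝓡) → Set) where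
  open RewriteTheory 𝓡
  open Rewriting 𝓡
  open Strategies 𝓡 SName

  private
    variable
      k h : Kind

  cterms-launch : ∀ {xs} σ (us : All (GTerm ∘ proj₁) xs) αs → cterms (launch σ us αs) ≡ us
  cterms-launch σ []       []       = refl
  cterms-launch σ (u ∷ us) (α ∷ αs) = cong (u ∷_) (cterms-launch σ us αs)

  cterms-solutions : ∀ {xs} (us : All (GTerm ∘ proj₁) xs) → cterms (All.map (_at ε) us) ≡ us
  cterms-solutions []       = refl
  cterms-solutions (u ∷ us) = cong (u ∷_) (cterms-solutions us)

  fill-residual : ∀ {xs σ} (P : Pat h) {b a} (us : All (GTerm ∘ proj₁) xs) →
                  (∀ {k} {x : Var k} (i : (k , x) ∈ xs) → σ k x ≡ just (All.lookup us i)) →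
                  residual xs σ P ≡ just b → σ ⊢ P ⇓ a → fill us b ≡ a
  fill-residual {xs = xs} {σ} P us bound = bind-inst signature filled P
    where
    open DecMembership _≟_ using (_∈?_)

    filled : ∀ {k} (x : Var k) {b a} →
             residual xs σ (var x) ≡ just b → σ k x ≡ just a → fill us b ≡ a
    filled {k} x p q with (k , x) ∈? xs
    filled {k} x refl q | yes i = just-injective (trans (sym (bound i)) q)
    -- Outside `xs` the residual holds the weakened ground value of `x`, and filling the holes
    -- undoes the weakening.
    filled {k} x p q | no _ with σ k x
    filled {k} x refl refl | no _ | just a = bind-bind-ground signature _ _ a

  -- Only position `i` changes. The claim is about lookups because these are the substitution that
  -- `fill` applies to the body, as `bind-cong` requires.
  lookup-cterms-≔ : ∀ {xs v} (qs : All (XS ∘ proj₁) xs) (i : v ∈ xs) {q′} →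
                    cterm (All.lookup qs i) ≈ cterm q′ →
                    ∀ {w} (j : w ∈ xs) →
                    All.lookup (cterms qs) j ≈ All.lookup (cterms (qs [ i ]≔ q′)) j
  lookup-cterms-≔ (q ∷ qs) (here refl) p (here refl) = p
  lookup-cterms-≔ (q ∷ qs) (here refl) p (there j)   = ≈-refl
  lookup-cterms-≔ (q ∷ qs) (there i)   p (here refl) = ≈-refl
  lookup-cterms-≔ (q ∷ qs) (there i)   p (there j)   = lookup-cterms-≔ qs i p j

  module _ {D : Definitions} (𝓢 : Semantics D) where
    open Semantics 𝓢
    open Denotation 𝓢

    -- Equality holds only modulo E, since `matchrew` replaces the term by the matched
    -- representative `plug c image`; a step inside a `subterm` state inherits this by congruence.
    →ᶜ-cterm : {q q′ : XS k} → q →ᶜ q′ → cterm q ≈ cterm q′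
    →ᶜ-cterm idle        = ≈-refl
    →ᶜ-cterm pop         = ≈-refl
    →ᶜ-cterm (match _)   = ≈-refl
    →ᶜ-cterm seq         = ≈-refl
    →ᶜ-cterm alt₁        = ≈-refl
    →ᶜ-cterm alt₂        = ≈-refl
    →ᶜ-cterm iter₀       = ≈-refl
    →ᶜ-cterm iter₁       = ≈-refl
    →ᶜ-cterm then        = ≈-refl
    →ᶜ-cterm (else _)    = ≈-refl
    →ᶜ-cterm (call _ _)  = ≈-refl
    →ᶜ-cterm (matchrew {P = P} {c = c} {σ} {us = us} {αs} {b} M bound res) =
      -- The launched substates carry the values of `xs` under `σ`; filling them in passes through
      -- the context and restores the image of `P`.
      ≈-trans (Match.matches M) (≈-reflexive 𝓡 (sym
        (trans (cong (λ vs → fill vs (plug (wkᶜ c) b)) (cterms-launch σ us αs))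
        (trans (bind-plug-wkᶜ signature _ c b)
               (cong (plug c) (fill-residual P us bound res (Match.instance-of M)))))))
    →ᶜ-cterm (subterm {qs = qs} {b} i st) =
      bind-cong 𝓡 (λ (_ , j) → lookup-cterms-≔ qs i (→ᶜ-cterm st) j) b
    →ᶜ-cterm (return {b = b} us refl) =
      ≈-reflexive 𝓡 (cong (λ vs → fill vs b) (cterms-solutions us))
    →ᶜ-cterm (rewc-start _ _ _ _ _ _ _) = ≈-refl
    →ᶜ-cterm (rewc-step _)              = ≈-refl
    →ᶜ-cterm (rewc-next _ _ _ _ _)      = ≈-refl

    →ᶜ*-cterm : {q q′ : XS k} → Star _→ᶜ_ q q′ → cterm q ≈ cterm q′
    →ᶜ*-cterm ε        = ≈-refl
    →ᶜ*-cterm (p ◅ ps) = ≈-trans (→ᶜ-cterm p) (→ᶜ*-cterm ps)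

    -- `Ex` lets the final solution carry any term, while `Sol` asks for the current term;
    -- preservation by control steps closes the gap.
    reaches⇒Sol : {q : XS k} → (∃ λ u → Star _→ᶜ_ q (u at ε)) → Sol q
    reaches⇒Sol (u , ps) = u , ≈-sym (→ᶜ*-cterm ps) , ps

    -- Paths of the Kripke structure and executions

    Path : (ℕ → State) → Set
    Path π = ∀ i → π i ⟶ π (suc i)

    Follows : (ℕ → State) → Word (XS k) → Set
    Follows π v = ∀ i → proj₁ (pair (π i)) ≡ (_ , stutter v i)

    haltingPath : ∀ n (v : Fin (suc n) → XS k) → Sol (v (fromℕ n)) → ℕ → State
    haltingPath n       v s zero    = inj₁ (_ , v zero)
    -- The last letter occurs once in the first copy, at index `n`, and from `n + 1` on in the
    -- second.
    haltingPath zero    v s (suc i) = inj₂ ((_ , v zero) , s)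
    haltingPath (suc n) v s (suc i) = haltingPath n (v ∘ suc) s i

    haltingPath-path : ∀ n (v : Fin (suc n) → XS k) (s : Sol (v (fromℕ n))) →
                       (∀ i → v (inject₁ i) ↠ v (suc i)) → Path (haltingPath n v s)
    haltingPath-path zero    v s steps zero    = stop
    haltingPath-path zero    v s steps (suc i) = stay
    haltingPath-path (suc n) v s steps zero    = run (steps zero)
    haltingPath-path (suc n) v s steps (suc i) = haltingPath-path n (v ∘ suc) s (steps ∘ suc) i

    haltingPath-follows : ∀ n (v : Fin (suc n) → XS k) (s : Sol (v (fromℕ n))) →
                          Follows (haltingPath n v s) (fin n v)
    haltingPath-follows n       v s zero    = refl
    haltingPath-follows zero    v s (suc i) = refl
    haltingPath-follows (suc n) v s (suc i) = haltingPath-follows n (v ∘ suc) s i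

    execution⇒path : ∀ {α} {t : GTerm k} {v} → Ex α t v →
                     ∃ λ π → π 0 ≡ inj₁ (k , (t at α ◂ ε)) × Path π × Follows π v
    execution⇒path (finite {n} {q} start steps end) =
      haltingPath n q s , cong (inj₁ ∘ (_ ,_)) start ,
      haltingPath-path n q s steps , haltingPath-follows n q s
      where s = reaches⇒Sol end
    execution⇒path (infinite {q} start steps) =
      (λ i → inj₁ (_ , q i)) , cong (inj₁ ∘ (_ ,_)) start , (λ i → run (steps i)) , λ _ → refl

    Halted : State → Set
    Halted x = proj₂ (pair x) ≡ true

    -- Only `stay` leaves a state of the second copy. It may change the proof of `Sol`, so just the
    -- underlying state is claimed constant.
    Halted-stays : ∀ {π kq s} → Path π → π 0 ≡ inj₂ (kq , s) → ∀ i → proj₁ (pair (π i)) ≡ kq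
    Halted-stays path start zero = cong (proj₁ ∘ pair) start
    Halted-stays {π} path start (suc i) with π 0 | π 1 in eq | path 0
    Halted-stays path refl (suc i) | _ | _ | stay = Halted-stays (path ∘ suc) eq i

    -- Induction on `N`, which only bounds the crossing time: `n` is the index of the last state in
    -- the first copy, and the target of `stop` supplies the proof of `Sol`.
    halting⇒finite : ∀ N {π} {q : XS k} → Path π → π 0 ≡ inj₁ (k , q) → Halted (π N) →
                     ∃ λ n → ∃ λ (v : Fin (suc n) → XS k) →
                     v zero ≡ q × (∀ i → v (inject₁ i) ↠ v (suc i)) × Sol (v (fromℕ n)) ×
                     Follows π (fin n v)
    halting⇒finite zero path start halted with () ← trans (cong (proj₂ ∘ pair) (sym start)) halted
    halting⇒finite (suc N) {π} path start halted with π 0 in eq₀ | π 1 in eq₁ | path 0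
    halting⇒finite (suc N) {q = q} path refl halted | _ | _ | stop {s = s} =
      0 , (λ _ → q) , refl , (λ ()) , s ,
      λ { zero → cong (proj₁ ∘ pair) eq₀ ; (suc i) → Halted-stays (path ∘ suc) eq₁ i }
    halting⇒finite (suc N) {q = q} path refl halted | _ | _ | run r
      with n , v , refl , steps , s , follows ← halting⇒finite N (path ∘ suc) eq₁ halted =
      suc n , q Vector.∷ v , refl , (λ { zero → r ; (suc i) → steps i }) , s ,
      λ { zero → cong (proj₁ ∘ pair) eq₀ ; (suc i) → follows i }

    -- With the second copy excluded every transition is a `run`, which also keeps the kind `k`, so
    -- the states form one sequence in `XS k`.
    running : ∀ {π} {q : XS k} → Path π → π 0 ≡ inj₁ (k , q) → ¬ ∃ (Halted ∘ π) →
              ∀ i → ∃ λ q′ → π i ≡ inj₁ (k , q′)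
    running path start ¬halted zero = _ , start
    running {π = π} path start ¬halted (suc i)
      with π i | proj₂ (running path start ¬halted i) | π (suc i) in eq | path i
    ... | _ | refl | _ | run r = _ , refl
    ... | _ | refl | _ | stop  = contradiction (_ , cong (proj₂ ∘ pair) eq) ¬halted

    run⁻¹ : {q q′ : XS k} → inj₁ (k , q) ⟶ inj₁ (k , q′) → q ↠ q′
    run⁻¹ (run r) = r

    path⇒execution : ExcludedMiddle 0ℓ → ∀ {α} {t : GTerm k} {π} →
                     Path π → π 0 ≡ inj₁ (k , (t at α ◂ ε)) → ∃ λ v → Ex α t v × Follows π v
    path⇒execution em {π = π} path start with em {∃ (Halted ∘ π)}
    ... | yes (N , halted)
      with n , v , v₀ , steps , (u , _ , ps) , follows ← halting⇒finite N path start halted =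
      fin n v , finite v₀ steps (u , ps) , follows
    ... | no ¬halted =
      inf (proj₁ ∘ states) ,
      infinite refl (λ i → run⁻¹ (subst₂ _⟶_ (proj₂ (states i)) (proj₂ (states (suc i))) (path i))) ,
      cong (proj₁ ∘ pair) ∘ proj₂ ∘ states
      where
      states = running path start ¬halted

    Follows-cterm : ∀ π (v : Word (XS k)) → Follows π v → ∀ i →
                    map₂ cterm (proj₁ (pair (π i))) ≈ᵀ
                    stutter (mapWord (λ q → _ , cterm q) v) i
    Follows-cterm π v follows i = IsEquivalence.reflexive ≈ᵀ-isEquivalence
      (trans (cong (map₂ cterm) (follows i)) (sym (stutter-mapWord _ v i)))

    -- Initial states are given by an equation between pairs; the bit `false` rules out the second
    -- copy.
    initial⁻¹ : ∀ {x} {q : ∃ XS} → pair x ≡ (q , false) → x ≡ inj₁ q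
    initial⁻¹ {inj₁ _} refl = refl

corollary1 : ExcludedMiddle 0ℓ →
    (𝓡 : RewriteTheory)
    (SName : List (RewriteTheory.Kind 𝓡) → Set)
    (D : Strategies.Definitions 𝓡 SName)
    (𝓢 : Strategies.Semantics 𝓡 SName D)
    {AP : Set} (𝓛 : Rewriting.Labeling 𝓡 AP)
    (α : Strategies.Strategy 𝓡 SName)
    {k : RewriteTheory.Kind 𝓡} (t : RewriteTheory.GTerm 𝓡 k)
    {ℓ : Level} (φ : Property AP ℓ) →
    (Rewriting.𝓜 𝓡 𝓛 ∣ Strategies.Denotation.E 𝓡 SName 𝓢 α t ⊨ φ)
    ⇔ (Strategies.Denotation.𝓜ₛ 𝓡 SName 𝓢 𝓛 α t ⊨ φ)
corollary1 em 𝓡 SName D 𝓢 𝓛 α t φ = mk⇔ paths executions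
  where
  open Rewriting 𝓡
  open Strategies 𝓡 SName
  open Denotation 𝓢
  open IsEquivalence ≈ᵀ-isEquivalence using ()
    renaming (refl to ≈ᵀ-refl; sym to ≈ᵀ-sym; trans to ≈ᵀ-trans)

  paths : 𝓜 𝓛 ∣ E α t ⊨ φ → 𝓜ₛ 𝓛 α t ⊨ φ
  paths sat π initial path
    with v , ex , follows ← path⇒execution 𝓡 SName 𝓢 em path (initial⁻¹ 𝓡 SName 𝓢 initial) =
    Holds-resp 𝓡 𝓛 φ (λ i → ≈ᵀ-sym (Follows-cterm 𝓡 SName 𝓢 π v follows i))
      -- The current terms of `v` themselves serve as representatives of the word in `E α t`.
      (sat _ (v , ex , PointwiseWord-refl ≈ᵀ-refl _))

  executions : 𝓜ₛ 𝓛 α t ⊨ φ → 𝓜 𝓛 ∣ E α t ⊨ φ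
  executions sat w (v , ex , v≈w)
    with π , start , path , follows ← execution⇒path 𝓡 SName 𝓢 ex =
    -- The word `w` agrees with the current terms of `v` only letterwise modulo E, and this carries
    -- over to the stuttering extensions.
    Holds-resp 𝓡 𝓛 φ (λ i → ≈ᵀ-trans (Follows-cterm 𝓡 SName 𝓢 π v follows i) (stutter-cong v≈w i))
      (sat π (cong pair start) path)
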